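{- For any $k\ge 2$, the maximum number of maximal cliques over all $n$-vertex graphs in $k\text{ -DIR}$ is $\Omega(n^{k(1-\epsilon)})$, for any $\epsilon>0$. Moreover, if $k$ is a constant, then the bound is $\Omega(n^{k})$.
   Context: For a collection of sets, its intersection graph has one vertex for each member of the collection, and two distinct vertices are adjacent if and only if the corresponding sets have nonempty intersection. $k\text{ -DIR}$ is the class of intersection graphs of collections of straight-line segments in the plane in which all the segments are parallel to at most $k$ directions. Maximal cliques are maximal with respect to inclusion. -}

module Defs where

open import Data.Bool.Base using (Bool; T)
open import Data.Bool.Properties as Bool using (T?)
open import Data.Fin.Base using (Fin)
import Data.Fin.Properties as Fin
open import Data.Fin.Subset using (Subset; inside; outside; _∈_; _⊆_)
open import Data.Fin.Subset.Properties using (_∈?_; _⊆?_; anySubset?)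
open import Data.Integer.Base using (ℤ; +_; -[1+_])
open import Data.List.Base using (List; []; _∷_; _++_; map; filter; length)
open import Data.Nat.Base as ℕ using (ℕ; zero; suc)
import Data.Nat.Properties as ℕ
open import Data.Product.Base using (Σ-syntax; ∃-syntax; _×_; _,_)
open import Data.Rational.Base as ℚ using (ℚ; 0ℚ; 1ℚ)
import Data.Rational.Properties as ℚ
open import Data.Rational.Solver using (module +-*-Solver)
open import Data.Sum.Base using (_⊎_)
open import Data.Vec.Base using ([]; _∷_)
import Data.Vec.Properties as Vec
open import Function.Bundles using (_⇔_)
open import Relation.Binary.PropositionalEquality using (_≡_; _≢_; refl; sym; trans; cong; subst)
open import Relation.Nullary using (¬_; Dec)
open import Relation.Nullary.Decidable using (_×-dec_; _→-dec_; ¬?; map′; decidable-stable)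

-- Cauchy sequences are not quotiented: equality of reals is _≈_ below.
IsCauchy : (ℕ → ℚ) → Set
IsCauchy s = ∀ ε → 0ℚ ℚ.< ε →
  ∃[ N ] (∀ m n → N ℕ.≤ m → N ℕ.≤ n → ℚ.∣ s m ℚ.- s n ∣ ℚ.≤ ε)

record ℝ : Set where
  constructor mkℝ
  field
    seq    : ℕ → ℚ
    cauchy : IsCauchy seq

open ℝ public

module Cauchy where
  0<½ε : ∀ {ε} → 0ℚ ℚ.< ε → 0ℚ ℚ.< ℚ.½ ℚ.* ε
  0<½ε {ε} 0<ε = subst (ℚ._< ℚ.½ ℚ.* ε) (ℚ.*-zeroʳ ℚ.½) (ℚ.*-monoʳ-<-pos ℚ.½ 0<ε)

  half : ∀ ε → ℚ.½ ℚ.* ε ℚ.+ ℚ.½ ℚ.* ε ≡ ε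
  half ε = trans (sym (ℚ.*-distribʳ-+ ε ℚ.½ ℚ.½)) (ℚ.*-identityˡ ε)

  +-cauchy : ∀ s t → IsCauchy s → IsCauchy t → IsCauchy (λ n → s n ℚ.+ t n)
  +-cauchy s t cs ct ε 0<ε
    with cs (ℚ.½ ℚ.* ε) (0<½ε 0<ε) | ct (ℚ.½ ℚ.* ε) (0<½ε 0<ε)
  ... | N , p | N′ , p′ = N ℕ.⊔ N′ , λ m n Nm Nn → begin
    ℚ.∣ (s m ℚ.+ t m) ℚ.- (s n ℚ.+ t n) ∣
      ≡⟨ cong ℚ.∣_∣ (rearrange (s m) (t m) (s n) (t n)) ⟩
    ℚ.∣ (s m ℚ.- s n) ℚ.+ (t m ℚ.- t n) ∣
      ≤⟨ ℚ.∣p+q∣≤∣p∣+∣q∣ (s m ℚ.- s n) (t m ℚ.- t n) ⟩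
    ℚ.∣ s m ℚ.- s n ∣ ℚ.+ ℚ.∣ t m ℚ.- t n ∣
      ≤⟨ ℚ.+-mono-≤ (p m n (ℕ.m⊔n≤o⇒m≤o N N′ Nm) (ℕ.m⊔n≤o⇒m≤o N N′ Nn))
                    (p′ m n (ℕ.m⊔n≤o⇒n≤o N N′ Nm) (ℕ.m⊔n≤o⇒n≤o N N′ Nn)) ⟩
    ℚ.½ ℚ.* ε ℚ.+ ℚ.½ ℚ.* ε ≡⟨ half ε ⟩
    ε ∎
    where
    open ℚ.≤-Reasoning
    rearrange : ∀ a b c d → (a ℚ.+ b) ℚ.- (c ℚ.+ d) ≡ (a ℚ.- c) ℚ.+ (b ℚ.- d)
    rearrange = solve 4 (λ a b c d → (a :+ b) :- (c :+ d) := (a :- c) :+ (b :- d)) refl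
      where open +-*-Solver

  neg-cauchy : ∀ s → IsCauchy s → IsCauchy (λ n → ℚ.- s n)
  neg-cauchy s cs ε 0<ε with cs ε 0<ε
  ... | N , p = N , λ m n Nm Nn →
    subst (ℚ._≤ ε) (trans (sym (ℚ.∣-p∣≡∣p∣ (s m ℚ.- s n)))
                          (cong ℚ.∣_∣ (ℚ.neg-distrib-+ (s m) (ℚ.- s n))))
          (p m n Nm Nn)

  eventuallyBounded : ∀ s → IsCauchy s →
    ∃[ B ] (0ℚ ℚ.< B × ∃[ N ] (∀ n → N ℕ.≤ n → ℚ.∣ s n ∣ ℚ.≤ B))
  eventuallyBounded s cs with cs 1ℚ (ℚ.positive⁻¹ 1ℚ)
  ... | N , p =
      1ℚ ℚ.+ ℚ.∣ s N ∣
    , ℚ.+-mono-<-≤ (ℚ.positive⁻¹ 1ℚ) (ℚ.0≤∣p∣ (s N))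
    , N , λ n Nn → begin
        ℚ.∣ s n ∣                          ≡⟨ cong ℚ.∣_∣ (split (s n) (s N)) ⟩
        ℚ.∣ (s n ℚ.- s N) ℚ.+ s N ∣        ≤⟨ ℚ.∣p+q∣≤∣p∣+∣q∣ (s n ℚ.- s N) (s N) ⟩
        ℚ.∣ s n ℚ.- s N ∣ ℚ.+ ℚ.∣ s N ∣    ≤⟨ ℚ.+-monoˡ-≤ ℚ.∣ s N ∣ (p n N Nn ℕ.≤-refl) ⟩
        1ℚ ℚ.+ ℚ.∣ s N ∣                   ∎
    where
    open ℚ.≤-Reasoning
    split : ∀ a b → a ≡ (a ℚ.- b) ℚ.+ b
    split = solve 2 (λ a b → a := (a :- b) :+ b) refl
      where open +-*-Solver

  ∣*∣-mono : ∀ x y {b c} → 0ℚ ℚ.≤ b →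
    ℚ.∣ x ∣ ℚ.≤ b → ℚ.∣ y ∣ ℚ.≤ c → ℚ.∣ x ℚ.* y ∣ ℚ.≤ b ℚ.* c
  ∣*∣-mono x y {b} {c} 0≤b x≤b y≤c = begin
    ℚ.∣ x ℚ.* y ∣          ≡⟨ ℚ.∣p*q∣≡∣p∣*∣q∣ x y ⟩
    ℚ.∣ x ∣ ℚ.* ℚ.∣ y ∣    ≤⟨ ℚ.*-monoʳ-≤-nonNeg ℚ.∣ y ∣ {{ℚ.∣-∣-nonNeg y}} x≤b ⟩
    b ℚ.* ℚ.∣ y ∣          ≤⟨ ℚ.*-monoˡ-≤-nonNeg b {{ℚ.nonNegative 0≤b}} y≤c ⟩
    b ℚ.* c                ∎
    where open ℚ.≤-Reasoning

  share : ∀ A B ε → 0ℚ ℚ.< A ℚ.+ B → 0ℚ ℚ.< ε →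
    ∃[ δ ] (0ℚ ℚ.< δ × A ℚ.* δ ℚ.+ δ ℚ.* B ≡ ε)
  share A B ε 0<A+B 0<ε = ε ℚ.* i , 0<δ ,
    trans (gather A B ε i)
      (trans (cong (ε ℚ.*_) (ℚ.*-inverseˡ (A ℚ.+ B) {{nz}})) (ℚ.*-identityʳ ε))
    where
    pos : ℚ.Positive (A ℚ.+ B)
    pos = ℚ.positive 0<A+B
    nz : ℚ.NonZero (A ℚ.+ B)
    nz = ℚ.pos⇒nonZero (A ℚ.+ B) {{pos}}
    i : ℚ
    i = ℚ.1/_ (A ℚ.+ B) {{nz}}
    0<δ : 0ℚ ℚ.< ε ℚ.* i
    0<δ = ℚ.positive⁻¹ (ε ℚ.* i)
      {{ℚ.pos*pos⇒pos ε {{ℚ.positive 0<ε}} i {{ℚ.1/pos⇒pos (A ℚ.+ B) {{pos}}}}}}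
    gather : ∀ a b e i → a ℚ.* (e ℚ.* i) ℚ.+ (e ℚ.* i) ℚ.* b ≡ e ℚ.* (i ℚ.* (a ℚ.+ b))
    gather = solve 4 (λ a b e i → a :* (e :* i) :+ (e :* i) :* b := e :* (i :* (a :+ b))) refl
      where open +-*-Solver

  *-cauchy : ∀ s t → IsCauchy s → IsCauchy t → IsCauchy (λ n → s n ℚ.* t n)
  *-cauchy s t cs ct ε 0<ε =
    let A , 0<A , K , bs   = eventuallyBounded s cs
        B , 0<B , L , bt   = eventuallyBounded t ct
        δ , 0<δ , sum      = share A B ε (ℚ.+-mono-< 0<A 0<B) 0<ε
        N , p              = cs δ 0<δ
        N′ , p′            = ct δ 0<δ
    in (K ℕ.⊔ L) ℕ.⊔ (N ℕ.⊔ N′) , λ m n Nm Nn →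
      let KLm = ℕ.m⊔n≤o⇒m≤o (K ℕ.⊔ L) (N ℕ.⊔ N′) Nm
          KLn = ℕ.m⊔n≤o⇒m≤o (K ℕ.⊔ L) (N ℕ.⊔ N′) Nn
          NNm = ℕ.m⊔n≤o⇒n≤o (K ℕ.⊔ L) (N ℕ.⊔ N′) Nm
          NNn = ℕ.m⊔n≤o⇒n≤o (K ℕ.⊔ L) (N ℕ.⊔ N′) Nn
      in product (s m) (t m) (s n) (t n) (ℚ.<⇒≤ 0<A) (ℚ.<⇒≤ 0<δ) sum
           (bs m (ℕ.m⊔n≤o⇒m≤o K L KLm))
           (p′ m n (ℕ.m⊔n≤o⇒n≤o N N′ NNm) (ℕ.m⊔n≤o⇒n≤o N N′ NNn))
           (p m n (ℕ.m⊔n≤o⇒m≤o N N′ NNm) (ℕ.m⊔n≤o⇒m≤o N N′ NNn))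
           (bt n (ℕ.m⊔n≤o⇒n≤o K L KLn))
    where
    rearrange : ∀ a b c d →
      a ℚ.* b ℚ.- c ℚ.* d ≡ a ℚ.* (b ℚ.- d) ℚ.+ (a ℚ.- c) ℚ.* d
    rearrange = solve 4 (λ a b c d → a :* b :- c :* d := a :* (b :- d) :+ (a :- c) :* d) refl
      where open +-*-Solver
    product : ∀ a b c d {A B δ ε} → 0ℚ ℚ.≤ A → 0ℚ ℚ.≤ δ →
      A ℚ.* δ ℚ.+ δ ℚ.* B ≡ ε →
      ℚ.∣ a ∣ ℚ.≤ A → ℚ.∣ b ℚ.- d ∣ ℚ.≤ δ → ℚ.∣ a ℚ.- c ∣ ℚ.≤ δ → ℚ.∣ d ∣ ℚ.≤ B →
      ℚ.∣ a ℚ.* b ℚ.- c ℚ.* d ∣ ℚ.≤ ε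
    product a b c d {A} {B} {δ} {ε} 0≤A 0≤δ sum a≤A bd ac d≤B = begin
      ℚ.∣ a ℚ.* b ℚ.- c ℚ.* d ∣                        ≡⟨ cong ℚ.∣_∣ (rearrange a b c d) ⟩
      ℚ.∣ a ℚ.* (b ℚ.- d) ℚ.+ (a ℚ.- c) ℚ.* d ∣        ≤⟨ ℚ.∣p+q∣≤∣p∣+∣q∣ (a ℚ.* (b ℚ.- d)) ((a ℚ.- c) ℚ.* d) ⟩
      ℚ.∣ a ℚ.* (b ℚ.- d) ∣ ℚ.+ ℚ.∣ (a ℚ.- c) ℚ.* d ∣  ≤⟨ ℚ.+-mono-≤ (∣*∣-mono a (b ℚ.- d) 0≤A a≤A bd)
                                                                     (∣*∣-mono (a ℚ.- c) d 0≤δ ac d≤B) ⟩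
      A ℚ.* δ ℚ.+ δ ℚ.* B                              ≡⟨ sum ⟩
      ε                                                ∎
      where open ℚ.≤-Reasoning

open Cauchy

infix  4 _≈_ _≤_ _<_ _#_
infixl 6 _+_ _-_
infixl 7 _*_
infixr 8 _^_ -_

fromℚ : ℚ → ℝ
fromℚ q = mkℝ (λ _ → q) λ ε 0<ε → 0 , λ _ _ _ _ →
  subst (λ z → ℚ.∣ z ∣ ℚ.≤ ε) (sym (ℚ.+-inverseʳ q)) (ℚ.<⇒≤ 0<ε)

fromℕ : ℕ → ℝ
fromℕ n = fromℚ (+ n ℚ./ 1)

0ℝ 1ℝ : ℝ
0ℝ = fromℚ 0ℚ
1ℝ = fromℚ 1ℚ

-_ : ℝ → ℝ
- x = mkℝ (λ n → ℚ.- seq x n) (neg-cauchy (seq x) (cauchy x))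

_+_ _-_ _*_ : ℝ → ℝ → ℝ
x + y = mkℝ (λ n → seq x n ℚ.+ seq y n) (+-cauchy (seq x) (seq y) (cauchy x) (cauchy y))
x - y = x + (- y)
x * y = mkℝ (λ n → seq x n ℚ.* seq y n) (*-cauchy (seq x) (seq y) (cauchy x) (cauchy y))

_^_ : ℝ → ℕ → ℝ
x ^ zero  = 1ℝ
x ^ suc n = x * x ^ n

_≈_ _≤_ _<_ _#_ : ℝ → ℝ → Set
x ≈ y = ∀ ε → 0ℚ ℚ.< ε →
  ∃[ N ] (∀ n → N ℕ.≤ n → ℚ.∣ seq x n ℚ.- seq y n ∣ ℚ.≤ ε)
x ≤ y = ∀ ε → 0ℚ ℚ.< ε →
  ∃[ N ] (∀ n → N ℕ.≤ n → seq x n ℚ.≤ seq y n ℚ.+ ε)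
x < y = ∃[ ε ] (0ℚ ℚ.< ε ×
  ∃[ N ] (∀ n → N ℕ.≤ n → seq x n ℚ.+ ε ℚ.≤ seq y n))
x # y = x < y ⊎ y < x

_^ℤ_ : (n : ℕ) .{{_ : ℕ.NonZero n}} → ℤ → ℝ
n ^ℤ (+ a)    = fromℕ (n ℕ.^ a)
n ^ℤ -[1+ b ] = fromℚ (ℚ._/_ (+ 1) (n ℕ.^ suc b) {{ℕ.m^n≢0 n (suc b)}})

-- c · n ^ α ≤ y, for real α, natural n ≥ 1, and c , y ≥ 0.  Since n ≥ 1, the
-- power n ^ α is the supremum of the n ^ (p / q) over rationals p / q < α, and
-- c · n ^ (p / q) ≤ y is expressed by its q-th power.
_·_^_≤ᴾ_ : ℝ → (n : ℕ) .{{_ : ℕ.NonZero n}} → ℝ → ℝ → Set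
c · n ^ α ≤ᴾ y = ∀ (p : ℤ) (q : ℕ) .{{_ : ℕ.NonZero q}} →
  fromℚ (p ℚ./ q) < α → c ^ q * (n ^ℤ p) ≤ y ^ q

Vector : Set
Vector = ℝ × ℝ

_≈ᵥ_ _#ᵥ_ : Vector → Vector → Set
(a , b) ≈ᵥ (c , d) = a ≈ c × b ≈ d
(a , b) #ᵥ (c , d) = a # c ⊎ b # d

0ᵥ : Vector
0ᵥ = 0ℝ , 0ℝ

_+ᵥ_ _-ᵥ_ : Vector → Vector → Vector
(a , b) +ᵥ (c , d) = a + c , b + d
(a , b) -ᵥ (c , d) = a - c , b - d

_*ᵥ_ : ℝ → Vector → Vector
t *ᵥ (a , b) = t * a , t * b

record Segment : Set where
  field
    P Q : Vector
    P#Q : P #ᵥ Q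

record Direction : Set where
  field
    vector  : Vector
    nonzero : vector #ᵥ 0ᵥ

infix 4 _∈ˢ_ _∥_

_∈ˢ_ : Vector → Segment → Set
X ∈ˢ s = ∃[ t ] (0ℝ ≤ t × t ≤ 1ℝ × X ≈ᵥ (P +ᵥ (t *ᵥ (Q -ᵥ P))))
  where open Segment s

Intersect : Segment → Segment → Set
Intersect s t = ∃[ X ] (X ∈ˢ s × X ∈ˢ t)

_∥_ : Segment → Direction → Set
s ∥ d = ∃[ r ] ((Q -ᵥ P) ≈ᵥ (r *ᵥ vector))
  where open Segment s; open Direction d

record Graph (n : ℕ) : Set where
  field
    adj    : Fin n → Fin n → Bool
    symm   : ∀ u v → T (adj u v) → T (adj v u)
    irrefl : ∀ u → ¬ T (adj u u)

  _~_ : Fin n → Fin n → Set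
  u ~ v = T (adj u v)

module _ {n : ℕ} (G : Graph n) where
  open Graph G

  IsClique : Subset n → Set
  IsClique S = ∀ u v → u ∈ S → v ∈ S → u ≢ v → u ~ v

  IsMaximalClique : Subset n → Set
  IsMaximalClique S = IsClique S × (∀ S′ → IsClique S′ → S ⊆ S′ → S′ ≡ S)

  isClique? : ∀ S → Dec (IsClique S)
  isClique? S = Fin.all? λ u → Fin.all? λ v →
    (u ∈? S) →-dec ((v ∈? S) →-dec (¬? (u Fin.≟ v) →-dec T? (adj u v)))

  isMaximalClique? : ∀ S → Dec (IsMaximalClique S)
  isMaximalClique? S = isClique? S ×-dec
    map′ (λ none S′ c S⊆S′ → decidable-stable (S′ ≟ S) λ S′≢S → none (S′ , c , (λ {x} → S⊆S′ {x}) , S′≢S))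
         (λ max (S′ , c , S⊆S′ , S′≢S) → S′≢S (max S′ c λ {x} → S⊆S′ {x}))
         (¬? (anySubset? λ S′ → isClique? S′ ×-dec ((S ⊆? S′) ×-dec ¬? (S′ ≟ S))))
    where
    _≟_ : (S S′ : Subset n) → Dec (S ≡ S′)
    _≟_ = Vec.≡-dec Bool._≟_

subsets : ∀ n → List (Subset n)
subsets zero    = [] ∷ []
subsets (suc n) = map (outside ∷_) (subsets n) ++ map (inside ∷_) (subsets n)

#maximalCliques : ∀ {n} → Graph n → ℕ
#maximalCliques {n} G = length (filter (isMaximalClique? G) (subsets n))

-- The family of directions may repeat, so "at most k directions" is meant.
_∈_-DIR : ∀ {n} → Graph n → ℕ → Set
_∈_-DIR {n} G k =
  Σ[ dir ∈ (Fin k → Direction) ] Σ[ seg ∈ (Fin n → Segment) ]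
    (∀ v → ∃[ i ] (seg v ∥ dir i)) ×
    (∀ u v → u ≢ v → (u ~ v) ⇔ Intersect (seg u) (seg v))
  where open Graph G

MaximalCliqueCount : (k n : ℕ) → ℕ → Set
MaximalCliqueCount k n m = Σ[ G ∈ Graph n ] (G ∈ k -DIR × #maximalCliques G ≡ m)

IsMaximum : (ℕ → Set) → ℕ → Set
IsMaximum A M = A M × (∀ m → A m → m ℕ.≤ M)

-- The maximum of A satisfies the (upward closed) lower bound B.  A bounded
-- inhabited set of naturals need not have a maximum constructively, so the
-- second component alone could hold for want of one; the first makes some
-- member of A witness the bound.
MaximumSatisfies : (A B : ℕ → Set) → Set
MaximumSatisfies A B = (∃[ m ] (A m × B m)) × (∀ M → IsMaximum A M → B M)

{-# OPTIONS --safe #-}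
module Submission where

-- Vertex v of {0, …, n − 1} is given column v mod k and row v / k, and is
-- represented by the segment over 0 ≤ x ≤ 1 of the line
--   y = j − n i + 2 n i x    (i its column, j its row),
-- so the column determines the direction.  Segments of one column lie on
-- distinct parallel lines; if i′ < i, a segment of column i starts below and
-- ends above every segment of column i′, because 0 ≤ j , j′ < n.  So the
-- intersection graph is complete k-partite, and choosing one vertex in each
-- column gives at least ⌊n / k⌋^k maximal cliques, which is at least
-- n^k / (2k)^k if n ≥ k.  For fixed k the factor (2k)^k is eventually at most
-- n^(kε), so the first part holds with c = 1.

open import Defs
open Cauchy using (0<½ε; half; ∣*∣-mono; share)
import Algebra.Properties.Group as Group
open import Data.Bool.Properties using (T-≡)
open import Data.Fin.Base as Fin using (Fin; toℕ; fromℕ<; finToFun; funToFin)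
import Data.Fin.Properties as Fin
open import Data.Fin.Subset using (Subset; inside; outside; _∈_; _⊆_)
open import Data.Fin.Subset.Properties using (⊆-antisym)
open import Data.Integer.Base as ℤ using (+_; -[1+_])
import Data.Integer.Properties as ℤ
open import Data.List.Base using (List; length)
import Data.List.Membership.Propositional as List
open import Data.List.Membership.Propositional.Properties
  using (∈-map⁺; ∈-++⁺ˡ; ∈-++⁺ʳ; ∈-filter⁺)
import Data.List.Membership.Setoid.Properties as Membership
open import Data.List.Relation.Unary.Any using (here; index)
open import Data.Nat.Base as ℕ using (ℕ; zero; suc)
open import Data.Nat.Divisibility using (n∣m*n)
open import Data.Nat.DivMod
  using (_/_; _%_; _mod_; m≡m%n+[m/n]*n; m%n<n; m/n*n≤m; m/n≤m; m≥n⇒m/n>0;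
         m<n⇒m%n≡m; m<n⇒m/n≡0; [m+kn]%n≡m%n; m*n/n≡m; +-distrib-/-∣ʳ)
import Data.Nat.Properties as ℕ
open import Data.Product.Base using (∃-syntax; _×_; _,_)
open import Data.Rational.Base as ℚ using (ℚ; 0ℚ; 1ℚ; mkℚ)
import Data.Rational.Properties as ℚ
open import Data.Rational.Solver using (module +-*-Solver)
open import Data.Rational.Unnormalised.Base as ℚᵘ using (mkℚᵘ; *≡*; *≤*; *<*)
import Data.Rational.Unnormalised.Properties as ℚᵘ
open import Data.Sum.Base using (inj₁; inj₂)
open import Data.Vec.Base using ([]; _∷_; tabulate)
open import Data.Vec.Properties using (lookup∘tabulate; []=⇒lookup; lookup⇒[]=)
open import Function.Bundles using (Equivalence; mk⇔)
open import Relation.Binary.Definitions using (tri<; tri≈; tri>)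
open import Relation.Binary.PropositionalEquality
  using (_≡_; _≢_; _≗_; refl; sym; trans; cong; cong₂; subst; subst₂; setoid; module ≡-Reasoning)
open import Relation.Nullary using (Dec; contradiction)
open import Relation.Nullary.Decidable
  using (⌊_⌋; ¬?; toWitness; fromWitness; decidable-stable; dec-true; isYes≗does)

-- Complete multipartite graphs

-- Each `f i` is sent to its position in `xs`. A position determines the entry found there, so this
-- is an injection into `Fin (length xs)`.
injection⇒≤length : ∀ {A : Set} {N} (f : Fin N → A) (xs : List A) →
  (∀ {i j} → f i ≡ f j → i ≡ j) → (∀ i → f i List.∈ xs) → N ℕ.≤ length xs
injection⇒≤length f xs f-inj f∈xs = Fin.injective⇒≤ {f = λ i → index (f∈xs i)}
  λ {i} {j} eq → f-inj (Membership.index-injective (setoid _) (f∈xs i) (f∈xs j) eq)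

∈-subsets : ∀ {n} (S : Subset n) → S List.∈ subsets n
∈-subsets []            = here refl
∈-subsets (outside ∷ S) = ∈-++⁺ˡ (∈-map⁺ (outside ∷_) (∈-subsets S))
∈-subsets (inside ∷ S)  = ∈-++⁺ʳ _ (∈-map⁺ (inside ∷_) (∈-subsets S))

module _ {n} {P : Fin n → Set} (P? : ∀ v → Dec (P v)) where

  comprehension : Subset n
  comprehension = tabulate λ v → ⌊ P? v ⌋

  ∈-comprehension⁺ : ∀ {v} → P v → v ∈ comprehension
  ∈-comprehension⁺ {v} p = lookup⇒[]= v _ (trans (lookup∘tabulate _ v) (trans (isYes≗does (P? v)) (dec-true (P? v) p)))

  ∈-comprehension⁻ : ∀ {v} → v ∈ comprehension → P v
  ∈-comprehension⁻ {v} v∈ = toWitness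
    (Equivalence.from T-≡ (trans (sym (lookup∘tabulate _ v)) ([]=⇒lookup v∈)))

*-^-distrib : ∀ a b k → (a ℕ.* b) ℕ.^ k ≡ a ℕ.^ k ℕ.* b ℕ.^ k
*-^-distrib a b zero    = refl
*-^-distrib a b (suc k) = trans (cong (a ℕ.* b ℕ.*_) (*-^-distrib a b k))
  (ℕ.[m*n]*[o*p]≡[m*o]*[n*p] a b (a ℕ.^ k) (b ℕ.^ k))

-- Stands in for function extensionality: the code of a function depends only on its values.
funToFin-cong : ∀ {m n} {f g : Fin m → Fin n} → f ≗ g → funToFin f ≡ funToFin g
funToFin-cong {zero}  f≗g = refl
funToFin-cong {suc m} f≗g = cong₂ Fin.combine (f≗g Fin.zero) (funToFin-cong λ i → f≗g (Fin.suc i))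

finToFun-injective : ∀ {m n} {i j : Fin (m ℕ.^ n)} → finToFun {m} {n} i ≗ finToFun j → i ≡ j
finToFun-injective {m} {n} {i} {j} eq =
  trans (sym (Fin.funToFin-finToFin {n} {m} i)) (trans (funToFin-cong {n} eq) (Fin.funToFin-finToFin {n} {m} j))

module Grid (k n : ℕ) .{{_ : ℕ.NonZero k}} where

  column : Fin n → Fin k
  column v = toℕ v mod k

  row : Fin n → ℕ
  row v = toℕ v / k

  row<n : ∀ v → row v ℕ.< n
  row<n v = ℕ.≤-<-trans (m/n≤m (toℕ v) k) (Fin.toℕ<n v)

  toℕ-column : ∀ v → toℕ (column v) ≡ toℕ v % k
  toℕ-column v = Fin.toℕ-fromℕ< (m%n<n (toℕ v) k)

  -- Column and row are remainder and quotient on division by `k`.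
  position-injective : ∀ {u v} → column u ≡ column v → row u ≡ row v → u ≡ v
  position-injective {u} {v} c r = Fin.toℕ-injective (begin
    toℕ u                              ≡⟨ m≡m%n+[m/n]*n (toℕ u) k ⟩
    toℕ u % k ℕ.+ row u ℕ.* k          ≡⟨ cong₂ (λ a b → a ℕ.+ b ℕ.* k) c′ r ⟩
    toℕ v % k ℕ.+ row v ℕ.* k          ≡⟨ m≡m%n+[m/n]*n (toℕ v) k ⟨
    toℕ v                              ∎)
    where
    open ≡-Reasoning
    c′ = trans (sym (toℕ-column u)) (trans (cong toℕ c) (toℕ-column v))

  -- Only the `n / k` complete rows are addressed, so that every column has a vertex in each of
  -- them.
  vertex : Fin k → Fin (n / k) → Fin n
  vertex i r = fromℕ< {toℕ i ℕ.+ toℕ r ℕ.* k} (begin-strict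
    toℕ i ℕ.+ toℕ r ℕ.* k  <⟨ ℕ.+-monoˡ-< _ (Fin.toℕ<n i) ⟩
    suc (toℕ r) ℕ.* k      ≤⟨ ℕ.*-monoˡ-≤ k (Fin.toℕ<n r) ⟩
    n / k ℕ.* k            ≤⟨ m/n*n≤m n k ⟩
    n                      ∎)
    where open ℕ.≤-Reasoning

  column-vertex : ∀ i r → column (vertex i r) ≡ i
  column-vertex i r = Fin.toℕ-injective (begin
    toℕ (column (vertex i r))        ≡⟨ toℕ-column (vertex i r) ⟩
    toℕ (vertex i r) % k             ≡⟨ cong (_% k) (Fin.toℕ-fromℕ< _) ⟩
    (toℕ i ℕ.+ toℕ r ℕ.* k) % k      ≡⟨ [m+kn]%n≡m%n (toℕ i) (toℕ r) k ⟩
    toℕ i % k                        ≡⟨ m<n⇒m%n≡m (Fin.toℕ<n i) ⟩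
    toℕ i                            ∎)
    where open ≡-Reasoning

  row-vertex : ∀ i r → row (vertex i r) ≡ toℕ r
  row-vertex i r = begin
    row (vertex i r)                      ≡⟨ cong (_/ k) (Fin.toℕ-fromℕ< _) ⟩
    (toℕ i ℕ.+ toℕ r ℕ.* k) / k           ≡⟨ +-distrib-/-∣ʳ (toℕ i) (n∣m*n (toℕ r)) ⟩
    toℕ i / k ℕ.+ toℕ r ℕ.* k / k         ≡⟨ cong₂ ℕ._+_ (m<n⇒m/n≡0 (Fin.toℕ<n i)) (m*n/n≡m (toℕ r) k) ⟩
    toℕ r                                 ∎
    where open ≡-Reasoning

  distinctColumns? : ∀ u v → Dec (column u ≢ column v)
  distinctColumns? u v = ¬? (column u Fin.≟ column v)

  completePartite : Graph n
  completePartite = record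
    { adj    = λ u v → ⌊ distinctColumns? u v ⌋
    ; symm   = λ u v u~v → fromWitness {a? = distinctColumns? v u}
                 λ eq → toWitness {a? = distinctColumns? u v} u~v (sym eq)
    ; irrefl = λ u u~u → toWitness {a? = distinctColumns? u u} u~u refl
    }

  open Graph completePartite

  ~⇒≢ : ∀ {u v} → u ~ v → column u ≢ column v
  ~⇒≢ {u} {v} = toWitness {a? = distinctColumns? u v}

  ≢⇒~ : ∀ {u v} → column u ≢ column v → u ~ v
  ≢⇒~ {u} {v} = fromWitness {a? = distinctColumns? u v}

  onTransversal? : (f : Fin k → Fin (n / k)) → ∀ v → Dec (row v ≡ toℕ (f (column v)))
  onTransversal? f v = row v ℕ.≟ toℕ (f (column v))

  transversal : (Fin k → Fin (n / k)) → Subset n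
  transversal f = comprehension (onTransversal? f)

  vertex∈transversal : ∀ f i → vertex i (f i) ∈ transversal f
  vertex∈transversal f i = ∈-comprehension⁺ (onTransversal? f)
    (trans (row-vertex i (f i)) (cong (λ j → toℕ (f j)) (sym (column-vertex i (f i)))))

  -- The member in column `i` of the first set also lies in the second, which reads its row as
  -- `g i`.
  transversal-injective : ∀ {f g} → transversal f ≡ transversal g → f ≗ g
  transversal-injective {f} {g} eq i = Fin.toℕ-injective (begin
    toℕ (f i)                  ≡⟨ row-vertex i (f i) ⟨
    row w                      ≡⟨ ∈-comprehension⁻ (onTransversal? g) (subst (w ∈_) eq (vertex∈transversal f i)) ⟩
    toℕ (g (column w))         ≡⟨ cong (λ j → toℕ (g j)) (column-vertex i (f i)) ⟩
    toℕ (g i)                  ∎)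
    where
    open ≡-Reasoning
    w = vertex i (f i)

  -- Two members in one column have the same row, hence are the same vertex.
  transversal-isClique : ∀ f → IsClique completePartite (transversal f)
  transversal-isClique f u v u∈ v∈ u≢v = ≢⇒~ λ c → u≢v (position-injective c (begin
    row u                  ≡⟨ ∈-comprehension⁻ (onTransversal? f) u∈ ⟩
    toℕ (f (column u))     ≡⟨ cong (λ j → toℕ (f j)) c ⟩
    toℕ (f (column v))     ≡⟨ ∈-comprehension⁻ (onTransversal? f) v∈ ⟨
    row v                  ∎))
    where open ≡-Reasoning

  transversal-isMaximalClique : ∀ f → IsMaximalClique completePartite (transversal f)
  transversal-isMaximalClique f = transversal-isClique f , maximal
    where
    maximal : ∀ S → IsClique completePartite S → transversal f ⊆ S → S ≡ transversal f
    maximal S clique f⊆S = ⊆-antisym S⊆f f⊆S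
      where
      S⊆f : S ⊆ transversal f
      S⊆f {v} v∈S = subst (_∈ transversal f) (sym v≡w) w∈f
        where
        w = vertex (column v) (f (column v))
        w∈f = vertex∈transversal f (column v)
        v≡w : v ≡ w
        -- `w` is the member of the transversal in the column of `v`. Were they distinct, the clique
        -- `S` would make them adjacent, although they share a column.
        v≡w = decidable-stable (v Fin.≟ w) λ v≢w →
          ~⇒≢ (clique v w v∈S (f⊆S w∈f) v≢w) (sym (column-vertex (column v) (f (column v))))

  [n/k]^k≤#maximalCliques : (n / k) ℕ.^ k ℕ.≤ #maximalCliques completePartite
  [n/k]^k≤#maximalCliques = injection⇒≤length (λ i → transversal (finToFun i)) _
    (λ eq → finToFun-injective {n / k} {k} (transversal-injective eq))
    (λ i → ∈-filter⁺ (isMaximalClique? completePartite) (∈-subsets _) (transversal-isMaximalClique (finToFun i)))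

-- As `k ≤ n`, the quotient `m` is at least 1, so the remainder is below `k ≤ m * k`. Hence
-- `n ≤ 2 * k * m`, and the k-th power is taken.
n^k≤[2k]^k*[n/k]^k : ∀ k n .{{_ : ℕ.NonZero k}} → k ℕ.≤ n →
  n ℕ.^ k ℕ.≤ (2 ℕ.* k) ℕ.^ k ℕ.* (n / k) ℕ.^ k
n^k≤[2k]^k*[n/k]^k k n k≤n = begin
  n ℕ.^ k                            ≤⟨ ℕ.^-monoˡ-≤ k n≤2k*m ⟩
  (2 ℕ.* k ℕ.* m) ℕ.^ k              ≡⟨ *-^-distrib (2 ℕ.* k) m k ⟩
  (2 ℕ.* k) ℕ.^ k ℕ.* m ℕ.^ k        ∎
  where
  open ℕ.≤-Reasoning
  m = n / k
  1≤m : 1 ℕ.≤ m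
  1≤m = m≥n⇒m/n>0 k≤n
  n≤2k*m : n ℕ.≤ 2 ℕ.* k ℕ.* m
  n≤2k*m = begin
    n                       ≡⟨ m≡m%n+[m/n]*n n k ⟩
    n % k ℕ.+ m ℕ.* k       ≤⟨ ℕ.+-monoˡ-≤ (m ℕ.* k) (ℕ.<⇒≤ (m%n<n n k)) ⟩
    k ℕ.+ m ℕ.* k           ≤⟨ ℕ.+-monoˡ-≤ (m ℕ.* k) (ℕ.m≤n*m k m {{ℕ.>-nonZero 1≤m}}) ⟩
    m ℕ.* k ℕ.+ m ℕ.* k     ≡⟨ cong (m ℕ.* k ℕ.+_) (ℕ.+-identityʳ (m ℕ.* k)) ⟨
    2 ℕ.* (m ℕ.* k)         ≡⟨ cong (2 ℕ.*_) (ℕ.*-comm m k) ⟩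
    2 ℕ.* (k ℕ.* m)         ≡⟨ ℕ.*-assoc 2 k m ⟨
    2 ℕ.* k ℕ.* m           ∎

-- Rational and real arithmetic

ι : ℕ → ℚ
ι n = + n ℚ./ 1

-- `ℚ._/_` reduces to lowest terms. Identities on such quotients are therefore checked on
-- unnormalised fractions, up to `≃`.
toℚᵘ-/ : ∀ p q → ℚ.toℚᵘ (p ℚ./ suc q) ℚᵘ.≃ mkℚᵘ p q
toℚᵘ-/ p q = ℚ.toℚᵘ-fromℚᵘ (mkℚᵘ p q)

ι-homo-+ : ∀ m n → ι (m ℕ.+ n) ≡ ι m ℚ.+ ι n
ι-homo-+ m n = ℚ.toℚᵘ-injective (begin
  ℚ.toℚᵘ (ι (m ℕ.+ n))                ≈⟨ toℚᵘ-/ (+ (m ℕ.+ n)) 0 ⟩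
  mkℚᵘ (+ (m ℕ.+ n)) 0                ≡⟨ cong (λ z → mkℚᵘ z 0) (cong₂ ℤ._+_ (ℤ.*-identityʳ (+ m)) (ℤ.*-identityʳ (+ n))) ⟨
  mkℚᵘ (+ m) 0 ℚᵘ.+ mkℚᵘ (+ n) 0      ≈⟨ ℚᵘ.+-cong (toℚᵘ-/ (+ m) 0) (toℚᵘ-/ (+ n) 0) ⟨
  ℚ.toℚᵘ (ι m) ℚᵘ.+ ℚ.toℚᵘ (ι n)      ≈⟨ ℚ.toℚᵘ-homo-+ (ι m) (ι n) ⟨
  ℚ.toℚᵘ (ι m ℚ.+ ι n)                ∎)
  where open ℚᵘ.≃-Reasoning

ι-homo-* : ∀ m n → ι (m ℕ.* n) ≡ ι m ℚ.* ι n
ι-homo-* m n = ℚ.toℚᵘ-injective (begin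
  ℚ.toℚᵘ (ι (m ℕ.* n))                ≈⟨ toℚᵘ-/ (+ (m ℕ.* n)) 0 ⟩
  mkℚᵘ (+ (m ℕ.* n)) 0                ≡⟨ cong (λ z → mkℚᵘ z 0) (ℤ.pos-* m n) ⟩
  mkℚᵘ (+ m) 0 ℚᵘ.* mkℚᵘ (+ n) 0      ≈⟨ ℚᵘ.*-cong (toℚᵘ-/ (+ m) 0) (toℚᵘ-/ (+ n) 0) ⟨
  ℚ.toℚᵘ (ι m) ℚᵘ.* ℚ.toℚᵘ (ι n)      ≈⟨ ℚ.toℚᵘ-homo-* (ι m) (ι n) ⟨
  ℚ.toℚᵘ (ι m ℚ.* ι n)                ∎)
  where open ℚᵘ.≃-Reasoning

ι-mono-≤ : ∀ {m n} → m ℕ.≤ n → ι m ℚ.≤ ι n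
ι-mono-≤ {m} {n} m≤n = ℚ.toℚᵘ-cancel-≤ (begin
  ℚ.toℚᵘ (ι m)  ≃⟨ toℚᵘ-/ (+ m) 0 ⟩
  mkℚᵘ (+ m) 0  ≤⟨ *≤* (ℤ.*-monoʳ-≤-nonNeg (+ 1) (ℤ.+≤+ m≤n)) ⟩
  mkℚᵘ (+ n) 0  ≃⟨ toℚᵘ-/ (+ n) 0 ⟨
  ℚ.toℚᵘ (ι n)  ∎)
  where open ℚᵘ.≤-Reasoning

ι-mono-< : ∀ {m n} → m ℕ.< n → ι m ℚ.< ι n
ι-mono-< {m} {n} m<n = ℚ.toℚᵘ-cancel-< (begin-strict
  ℚ.toℚᵘ (ι m)  ≃⟨ toℚᵘ-/ (+ m) 0 ⟩
  mkℚᵘ (+ m) 0  <⟨ *<* (ℤ.*-monoʳ-<-pos (+ 1) (ℤ.+<+ m<n)) ⟩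
  mkℚᵘ (+ n) 0  ≃⟨ toℚᵘ-/ (+ n) 0 ⟨
  ℚ.toℚᵘ (ι n)  ∎)
  where open ℚᵘ.≤-Reasoning

ι-cancel-≤ : ∀ {m n} → ι m ℚ.≤ ι n → m ℕ.≤ n
ι-cancel-≤ ιm≤ιn = ℕ.≮⇒≥ λ n<m → ℚ.<-irrefl refl (ℚ.<-≤-trans (ι-mono-< n<m) ιm≤ιn)

ι-injective : ∀ {m n} → ι m ≡ ι n → m ≡ n
ι-injective eq = ℕ.≤-antisym (ι-cancel-≤ (ℚ.≤-reflexive eq)) (ι-cancel-≤ (ℚ.≤-reflexive (sym eq)))

ι-nonNegative : ∀ n → ℚ.NonNegative (ι n)
ι-nonNegative n = ℚ.normalize-nonNeg n 1

ι-positive : ∀ n .{{_ : ℕ.NonZero n}} → ℚ.Positive (ι n)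
ι-positive n = ℚ.normalize-pos n 1

/-*-cancel : ∀ p q .{{_ : ℕ.NonZero q}} → (+ p ℚ./ q) ℚ.* ι q ≡ ι p
/-*-cancel p (suc q) = ℚ.toℚᵘ-injective (begin
  ℚ.toℚᵘ ((+ p ℚ./ suc q) ℚ.* ι (suc q))                ≈⟨ ℚ.toℚᵘ-homo-* (+ p ℚ./ suc q) (ι (suc q)) ⟩
  ℚ.toℚᵘ (+ p ℚ./ suc q) ℚᵘ.* ℚ.toℚᵘ (ι (suc q))        ≈⟨ ℚᵘ.*-cong (toℚᵘ-/ (+ p) q) (toℚᵘ-/ (+ suc q) 0) ⟩
  mkℚᵘ (+ p) q ℚᵘ.* mkℚᵘ (+ suc q) 0                    ≈⟨ *≡* (ℤ.*-assoc (+ p) (+ suc q) (+ 1)) ⟩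
  mkℚᵘ (+ p) 0                                          ≈⟨ toℚᵘ-/ (+ p) 0 ⟨
  ℚ.toℚᵘ (ι p)                                          ∎)
  where open ℚᵘ.≃-Reasoning

seq-^ : ∀ m k i → seq (fromℕ m ^ k) i ≡ ι (m ℕ.^ k)
seq-^ m zero    i = refl
seq-^ m (suc k) i = trans (cong (ι m ℚ.*_) (seq-^ m k i)) (sym (ι-homo-* m (m ℕ.^ k)))

-- Lifts rational inequalities to reals; it is applied to constant sequences and to powers and
-- products of them.
≤-pointwise : ∀ {x y} → (∀ i → seq x i ℚ.≤ seq y i) → x ≤ y
≤-pointwise {x} {y} x≤y ε 0<ε = 0 , λ i _ →
  ℚ.≤-trans (x≤y i) (ℚ.≤-trans (ℚ.≤-reflexive (sym (ℚ.+-identityʳ (seq y i)))) (ℚ.+-monoʳ-≤ (seq y i) (ℚ.<⇒≤ 0<ε)))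

≈-pointwise : ∀ {x y} → (∀ i → seq x i ≡ seq y i) → x ≈ y
≈-pointwise {x} {y} x≡y ε 0<ε = 0 , λ i _ → subst (λ z → ℚ.∣ z ∣ ℚ.≤ ε)
  (sym (trans (cong (ℚ._- seq y i) (x≡y i)) (ℚ.+-inverseʳ (seq y i)))) (ℚ.<⇒≤ 0<ε)

≈-sym : ∀ {x y} → x ≈ y → y ≈ x
≈-sym {x} {y} x≈y ε 0<ε with x≈y ε 0<ε
... | N , p = N , λ i Ni → subst (ℚ._≤ ε)
  (trans (sym (ℚ.∣-p∣≡∣p∣ _)) (cong ℚ.∣_∣ (flip (seq x i) (seq y i)))) (p i Ni)
  where
  flip : ∀ a b → ℚ.- (a ℚ.- b) ≡ b ℚ.- a
  flip = solve 2 (λ a b → :- (a :- b) := b :- a) refl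
    where open +-*-Solver

≈-trans : ∀ {x y z} → x ≈ y → y ≈ z → x ≈ z
≈-trans {x} {y} {z} x≈y y≈z ε 0<ε with x≈y _ (0<½ε 0<ε) | y≈z _ (0<½ε 0<ε)
... | N , p | N′ , p′ = N ℕ.⊔ N′ , λ i Ni → begin
  ℚ.∣ seq x i ℚ.- seq z i ∣                                  ≡⟨ cong ℚ.∣_∣ (split (seq x i) (seq y i) (seq z i)) ⟩
  ℚ.∣ (seq x i ℚ.- seq y i) ℚ.+ (seq y i ℚ.- seq z i) ∣      ≤⟨ ℚ.∣p+q∣≤∣p∣+∣q∣ (seq x i ℚ.- seq y i) (seq y i ℚ.- seq z i) ⟩
  ℚ.∣ seq x i ℚ.- seq y i ∣ ℚ.+ ℚ.∣ seq y i ℚ.- seq z i ∣    ≤⟨ ℚ.+-mono-≤ (p i (ℕ.m⊔n≤o⇒m≤o N N′ Ni)) (p′ i (ℕ.m⊔n≤o⇒n≤o N N′ Ni)) ⟩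
  ℚ.½ ℚ.* ε ℚ.+ ℚ.½ ℚ.* ε                                    ≡⟨ half ε ⟩
  ε                                                          ∎
  where
  open ℚ.≤-Reasoning
  split : ∀ a b c → a ℚ.- c ≡ (a ℚ.- b) ℚ.+ (b ℚ.- c)
  split = solve 3 (λ a b c → a :- c := (a :- b) :+ (b :- c)) refl
    where open +-*-Solver

½ε<ε : ∀ {ε} → 0ℚ ℚ.< ε → ℚ.½ ℚ.* ε ℚ.< ε
½ε<ε {ε} 0<ε = begin-strict
  ℚ.½ ℚ.* ε                  ≡⟨ ℚ.+-identityʳ (ℚ.½ ℚ.* ε) ⟨
  ℚ.½ ℚ.* ε ℚ.+ 0ℚ           <⟨ ℚ.+-monoʳ-< (ℚ.½ ℚ.* ε) (0<½ε 0<ε) ⟩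
  ℚ.½ ℚ.* ε ℚ.+ ℚ.½ ℚ.* ε    ≡⟨ half ε ⟩
  ε                          ∎
  where open ℚ.≤-Reasoning

p≢q⇒0<∣p-q∣ : ∀ {p q} → p ≢ q → 0ℚ ℚ.< ℚ.∣ p ℚ.- q ∣
p≢q⇒0<∣p-q∣ {p} {q} p≢q = ℚ.≰⇒> λ d≤0 → p≢q (begin
  p                   ≡⟨ split p q ⟩
  (p ℚ.- q) ℚ.+ q     ≡⟨ cong (ℚ._+ q) (ℚ.∣p∣≡0⇒p≡0 (p ℚ.- q) (ℚ.≤-antisym d≤0 (ℚ.0≤∣p∣ (p ℚ.- q)))) ⟩
  0ℚ ℚ.+ q            ≡⟨ ℚ.+-identityˡ q ⟩
  q                   ∎)
  where
  open ≡-Reasoning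
  split : ∀ a b → a ≡ (a ℚ.- b) ℚ.+ b
  split = solve 2 (λ a b → a := (a :- b) :+ b) refl
    where open +-*-Solver

-- Distinct rationals stay a fixed positive distance apart, which contradicts closeness within half
-- of it. Since equality on `ℚ` is decidable, the contradiction suffices.
fromℚ-injective : ∀ {p q} → fromℚ p ≈ fromℚ q → p ≡ q
fromℚ-injective {p} {q} p≈q = decidable-stable (p ℚ.≟ q) λ p≢q →
  let 0<d = p≢q⇒0<∣p-q∣ p≢q
      N , bound = p≈q (ℚ.½ ℚ.* ℚ.∣ p ℚ.- q ∣) (0<½ε 0<d)
  in ℚ.<-irrefl refl (ℚ.<-≤-trans (½ε<ε 0<d) (bound N ℕ.≤-refl))

-- Segments across the strip 0 ≤ x ≤ 1

stripDirection : ℚ → Direction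
stripDirection s = record
  { vector  = 1ℝ , fromℚ s
  ; nonzero = inj₁ (inj₂ (1ℚ , ℚ.positive⁻¹ 1ℚ , 0 , λ _ _ → ℚ.≤-refl))
  }

-- The part of the line y = p + s x above 0 ≤ x ≤ 1.
stripSegment : (p s : ℚ) → Segment
stripSegment p s = record
  { P   = 0ℝ , fromℚ p
  ; Q   = 1ℝ , fromℚ (p ℚ.+ s)
  ; P#Q = inj₁ (inj₁ (1ℚ , ℚ.positive⁻¹ 1ℚ , 0 , λ _ _ → ℚ.≤-refl))
  }

stripSegment-∥ : ∀ p s → stripSegment p s ∥ stripDirection s
stripSegment-∥ p s = 1ℝ , ≈-pointwise {1ℝ - 0ℝ} {1ℝ * 1ℝ} (λ _ → refl)
                       , ≈-pointwise {fromℚ (p ℚ.+ s) - fromℚ p} {1ℝ * fromℚ s} (λ _ → lemma p s)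
  where
  lemma : ∀ p s → (p ℚ.+ s) ℚ.- p ≡ 1ℚ ℚ.* s
  lemma = solve 2 (λ p s → (p :+ s) :- p := con 1ℚ :* s) refl
    where open +-*-Solver

-- The endpoints lie over 0 and 1, so the parameter along a strip segment is the abscissa itself.
abscissa : ∀ t → 0ℚ ℚ.+ t ℚ.* (1ℚ ℚ.- 0ℚ) ≡ t
abscissa t = trans (ℚ.+-identityˡ (t ℚ.* 1ℚ)) (ℚ.*-identityʳ t)

ordinate : ∀ p s t → p ℚ.+ t ℚ.* ((p ℚ.+ s) ℚ.- p) ≡ p ℚ.+ s ℚ.* t
ordinate = solve 3 (λ p s t → p :+ t :* ((p :+ s) :- p) := p :+ s :* t) refl
  where open +-*-Solver

∈-stripSegment⁺ : ∀ {t} p s → 0ℚ ℚ.≤ t → t ℚ.≤ 1ℚ →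
  (fromℚ t , fromℚ (p ℚ.+ s ℚ.* t)) ∈ˢ stripSegment p s
∈-stripSegment⁺ {t} p s 0≤t t≤1 = fromℚ t
  , ≤-pointwise {0ℝ} {fromℚ t} (λ _ → 0≤t)
  , ≤-pointwise {fromℚ t} {1ℝ} (λ _ → t≤1)
  , ≈-pointwise {fromℚ t} {0ℝ + fromℚ t * (1ℝ - 0ℝ)} (λ _ → sym (abscissa t))
  , ≈-pointwise {fromℚ (p ℚ.+ s ℚ.* t)} {fromℚ p + fromℚ t * (fromℚ (p ℚ.+ s) - fromℚ p)}
      (λ _ → sym (ordinate p s t))

-- On the line, `y - s x` equals `p`; an error in `x` enters multiplied by `s`. The factor `1ℚ` puts
-- the bound in the shape produced by `share`.
line-residual : ∀ {δ} a b t p s → 0ℚ ℚ.≤ δ →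
  ℚ.∣ a ℚ.- t ∣ ℚ.≤ δ → ℚ.∣ b ℚ.- (p ℚ.+ s ℚ.* t) ∣ ℚ.≤ δ →
  ℚ.∣ (b ℚ.- s ℚ.* a) ℚ.- p ∣ ℚ.≤ 1ℚ ℚ.* δ ℚ.+ δ ℚ.* ℚ.∣ s ∣
line-residual {δ} a b t p s 0≤δ da db = begin
  ℚ.∣ (b ℚ.- s ℚ.* a) ℚ.- p ∣          ≡⟨ cong ℚ.∣_∣ (split a b t p s) ⟩
  ℚ.∣ v ℚ.+ u ℚ.* (ℚ.- s) ∣            ≤⟨ ℚ.∣p+q∣≤∣p∣+∣q∣ v (u ℚ.* (ℚ.- s)) ⟩
  ℚ.∣ v ∣ ℚ.+ ℚ.∣ u ℚ.* (ℚ.- s) ∣      ≤⟨ ℚ.+-mono-≤ db (∣*∣-mono u (ℚ.- s) 0≤δ da (ℚ.≤-reflexive (ℚ.∣-p∣≡∣p∣ s))) ⟩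
  δ ℚ.+ δ ℚ.* ℚ.∣ s ∣                  ≡⟨ cong (ℚ._+ δ ℚ.* ℚ.∣ s ∣) (ℚ.*-identityˡ δ) ⟨
  1ℚ ℚ.* δ ℚ.+ δ ℚ.* ℚ.∣ s ∣           ∎
  where
  open ℚ.≤-Reasoning
  u = a ℚ.- t
  v = b ℚ.- (p ℚ.+ s ℚ.* t)
  split : ∀ a b t p s → (b ℚ.- s ℚ.* a) ℚ.- p ≡
    (b ℚ.- (p ℚ.+ s ℚ.* t)) ℚ.+ (a ℚ.- t) ℚ.* (ℚ.- s)
  split = solve 5 (λ a b t p s →
    (b :- s :* a) :- p := (b :- (p :+ s :* t)) :+ (a :- t) :* (:- s)) refl
    where open +-*-Solver

-- A point of the segment is known only up to `≈`, so its coordinates are approximated within the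
-- `δ` for which the error of `line-residual` is exactly `ε`.
∈-stripSegment⁻ : ∀ {x y} p s → (x , y) ∈ˢ stripSegment p s → y - fromℚ s * x ≈ fromℚ p
∈-stripSegment⁻ {x} {y} p s (t , _ , _ , x≈ , y≈) ε 0<ε =
  let δ , 0<δ , sum = share 1ℚ ℚ.∣ s ∣ ε (ℚ.+-mono-<-≤ (ℚ.positive⁻¹ 1ℚ) (ℚ.0≤∣p∣ s)) 0<ε
      N  , bx = x≈ δ 0<δ
      N′ , by = y≈ δ 0<δ
  in N ℕ.⊔ N′ , λ i Ni → subst (ℚ.∣ (seq y i ℚ.- s ℚ.* seq x i) ℚ.- p ∣ ℚ.≤_) sum
       (line-residual (seq x i) (seq y i) (seq t i) p s (ℚ.<⇒≤ 0<δ)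
         (subst (λ z → ℚ.∣ seq x i ℚ.- z ∣ ℚ.≤ δ) (abscissa (seq t i)) (bx i (ℕ.m⊔n≤o⇒m≤o N N′ Ni)))
         (subst (λ z → ℚ.∣ seq y i ℚ.- z ∣ ℚ.≤ δ) (ordinate p s (seq t i)) (by i (ℕ.m⊔n≤o⇒n≤o N N′ Ni))))

-- At a common point, `y - s x` equals both intercepts.
parallel-intersect⇒≡ : ∀ {p p′ s} → Intersect (stripSegment p s) (stripSegment p′ s) → p ≡ p′
parallel-intersect⇒≡ {p} {p′} {s} (X@(x , y) , X∈ , X∈′) = fromℚ-injective
  (≈-trans {fromℚ p} {z} {fromℚ p′}
    (≈-sym {z} {fromℚ p} (∈-stripSegment⁻ {x} {y} p s X∈)) (∈-stripSegment⁻ {x} {y} p′ s X∈′))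
  where z = y - fromℚ s * x

-- The second line is above the first by `u` at the left end and below it by `w` at the right end.
-- The difference is linear, so it vanishes at `t = u / (u + w)`, which lies in the unit interval.
crossing⇒intersect : ∀ {p p′ s s′} → p ℚ.< p′ → p′ ℚ.+ s′ ℚ.< p ℚ.+ s →
  Intersect (stripSegment p s) (stripSegment p′ s′)
crossing⇒intersect {p} {p′} {s} {s′} left right =
  (fromℚ t , fromℚ (p ℚ.+ s ℚ.* t)) , ∈-stripSegment⁺ p s 0≤t t≤1 ,
  subst (λ z → (fromℚ t , fromℚ z) ∈ˢ stripSegment p′ s′) (sym meet) (∈-stripSegment⁺ p′ s′ 0≤t t≤1)
  where
  0<- : ∀ {a b} → a ℚ.< b → 0ℚ ℚ.< b ℚ.- a
  0<- {a} {b} a<b = subst (ℚ._< b ℚ.- a) (ℚ.+-inverseʳ a) (ℚ.+-monoˡ-< (ℚ.- a) a<b)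
  u w : ℚ
  u = p′ ℚ.- p
  w = (p ℚ.+ s) ℚ.- (p′ ℚ.+ s′)
  0<u : 0ℚ ℚ.< u
  0<u = 0<- left
  0<w : 0ℚ ℚ.< w
  0<w = 0<- right
  instance
    u+w-positive : ℚ.Positive (u ℚ.+ w)
    u+w-positive = ℚ.positive (ℚ.+-mono-< 0<u 0<w)
    u+w-nonZero : ℚ.NonZero (u ℚ.+ w)
    u+w-nonZero = ℚ.pos⇒nonZero (u ℚ.+ w)
  t : ℚ
  t = u ℚ.* ℚ.1/ (u ℚ.+ w)
  t*[u+w] : t ℚ.* (u ℚ.+ w) ≡ u
  t*[u+w] = trans (ℚ.*-assoc u _ _)
    (trans (cong (u ℚ.*_) (ℚ.*-inverseˡ (u ℚ.+ w))) (ℚ.*-identityʳ u))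
  0≤t : 0ℚ ℚ.≤ t
  0≤t = ℚ.*-cancelʳ-≤-pos (u ℚ.+ w) (begin
    0ℚ ℚ.* (u ℚ.+ w)  ≡⟨ ℚ.*-zeroˡ (u ℚ.+ w) ⟩
    0ℚ                ≤⟨ ℚ.<⇒≤ 0<u ⟩
    u                 ≡⟨ t*[u+w] ⟨
    t ℚ.* (u ℚ.+ w)   ∎)
    where open ℚ.≤-Reasoning
  t≤1 : t ℚ.≤ 1ℚ
  t≤1 = ℚ.*-cancelʳ-≤-pos (u ℚ.+ w) (begin
    t ℚ.* (u ℚ.+ w)   ≡⟨ t*[u+w] ⟩
    u                 ≡⟨ ℚ.+-identityʳ u ⟨
    u ℚ.+ 0ℚ          ≤⟨ ℚ.+-monoʳ-≤ u (ℚ.<⇒≤ 0<w) ⟩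
    u ℚ.+ w           ≡⟨ ℚ.*-identityˡ (u ℚ.+ w) ⟨
    1ℚ ℚ.* (u ℚ.+ w)  ∎)
    where open ℚ.≤-Reasoning
  meet : p ℚ.+ s ℚ.* t ≡ p′ ℚ.+ s′ ℚ.* t
  -- The sum `u + w` is the difference of slopes `s - s′`, so `s t` is `s′ t + t (u + w)`, that is
  -- `s′ t + u`.
  meet = trans (expand p p′ s s′ t) (trans (cong (λ z → (p ℚ.+ s′ ℚ.* t) ℚ.+ z) t*[u+w]) (collect p p′ s′ t))
    where
    open +-*-Solver
    expand : ∀ p p′ s s′ t → p ℚ.+ s ℚ.* t ≡
      (p ℚ.+ s′ ℚ.* t) ℚ.+ t ℚ.* ((p′ ℚ.- p) ℚ.+ ((p ℚ.+ s) ℚ.- (p′ ℚ.+ s′)))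
    expand = solve 5 (λ p p′ s s′ t → p :+ s :* t :=
      (p :+ s′ :* t) :+ t :* ((p′ :- p) :+ ((p :+ s) :- (p′ :+ s′)))) refl
    collect : ∀ p p′ s′ t → (p ℚ.+ s′ ℚ.* t) ℚ.+ (p′ ℚ.- p) ≡ p′ ℚ.+ s′ ℚ.* t
    collect = solve 4 (λ p p′ s′ t → (p :+ s′ :* t) :+ (p′ :- p) := p′ :+ s′ :* t) refl

Intersect-sym : ∀ {s t} → Intersect s t → Intersect t s
Intersect-sym (X , X∈s , X∈t) = X , X∈t , X∈s

-- Turns a comparison of intercepts into one of sums, which can be made among natural numbers.
-‿mono-< : ∀ {a b c d} → a ℚ.+ d ℚ.< c ℚ.+ b → a ℚ.- b ℚ.< c ℚ.- d
-‿mono-< {a} {b} {c} {d} lt = subst₂ ℚ._<_ (left a b d) (right b c d)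
  (ℚ.+-monoˡ-< (ℚ.- (b ℚ.+ d)) lt)
  where
  open +-*-Solver
  left : ∀ a b d → (a ℚ.+ d) ℚ.- (b ℚ.+ d) ≡ a ℚ.- b
  left = solve 3 (λ a b d → (a :+ d) :- (b :+ d) := a :- b) refl
  right : ∀ b c d → (c ℚ.+ b) ℚ.- (b ℚ.+ d) ≡ c ℚ.- d
  right = solve 3 (λ b c d → (c :+ b) :- (b :+ d) := c :- d) refl

-- Segment representation of the complete multipartite graph

module LongSegments (n : ℕ) where

  height : ℕ → ℚ
  height i = ι (n ℕ.* i)

  -- Doubling makes the right end `ι j + height i` mirror the left end `ι j - height i`, so one
  -- inequality serves at both ends.
  slope : ℕ → ℚ
  slope i = height i ℚ.+ height i

  intercept : ℕ → ℕ → ℚ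
  intercept i j = ι j ℚ.- height i

  longSegment : ℕ → ℕ → Segment
  longSegment i j = stripSegment (intercept i j) (slope i)

  intercept-injective : ∀ i {j j′} → intercept i j ≡ intercept i j′ → j ≡ j′
  intercept-injective i eq = ι-injective (Group.∙-cancelʳ ℚ.+-0-group (ℚ.- height i) _ _ eq)

  -- Rows differ by less than `n`, while the heights of distinct columns differ by at least `n`.
  -- This gives `gap`, used once for each end with the rows exchanged.
  steeper⇒intersect : ∀ {i i′ j j′} → i′ ℕ.< i → j ℕ.< n → j′ ℕ.< n →
    Intersect (longSegment i j) (longSegment i′ j′)
  steeper⇒intersect {i} {i′} {j} {j′} i′<i j<n j′<n = crossing⇒intersect
    (-‿mono-< {ι j} {height i} {ι j′} {height i′} (gap j j′ j<n))
    (subst₂ ℚ._<_ (sym (end (ι j′) (height i′))) (sym (end (ι j) (height i))) (gap j′ j j′<n))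
    where
    end : ∀ a h → (a ℚ.- h) ℚ.+ (h ℚ.+ h) ≡ a ℚ.+ h
    end = solve 2 (λ a h → (a :- h) :+ (h :+ h) := a :+ h) refl
      where open +-*-Solver
    gap : ∀ j j′ → j ℕ.< n → ι j ℚ.+ height i′ ℚ.< ι j′ ℚ.+ height i
    gap j j′ j<n = subst₂ ℚ._<_ (ι-homo-+ j (n ℕ.* i′)) (ι-homo-+ j′ (n ℕ.* i)) (ι-mono-< (begin-strict
      j ℕ.+ n ℕ.* i′     <⟨ ℕ.+-monoˡ-< (n ℕ.* i′) j<n ⟩
      n ℕ.+ n ℕ.* i′     ≡⟨ ℕ.*-suc n i′ ⟨
      n ℕ.* suc i′       ≤⟨ ℕ.*-monoʳ-≤ n i′<i ⟩
      n ℕ.* i            ≤⟨ ℕ.m≤n+m (n ℕ.* i) j′ ⟩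
      j′ ℕ.+ n ℕ.* i     ∎))
      where open ℕ.≤-Reasoning

module _ (k n : ℕ) .{{_ : ℕ.NonZero k}} where
  open Grid k n
  open LongSegments n
  open Graph completePartite using (_~_)

  segment : Fin n → Segment
  segment v = longSegment (toℕ (column v)) (row v)

  ~⇒intersect : ∀ {u v} → u ~ v → Intersect (segment u) (segment v)
  ~⇒intersect {u} {v} u~v with ℕ.<-cmp (toℕ (column u)) (toℕ (column v))
  ... | tri< u<v _ _ = Intersect-sym {segment v} {segment u} (steeper⇒intersect u<v (row<n v) (row<n u))
  ... | tri≈ _ u≡v _ = contradiction (Fin.toℕ-injective u≡v) (~⇒≢ u~v)
  ... | tri> _ _ v<u = steeper⇒intersect v<u (row<n u) (row<n v)

  intersect⇒~ : ∀ {u v} → u ≢ v → Intersect (segment u) (segment v) → u ~ v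
  intersect⇒~ {u} {v} u≢v meet = ≢⇒~ λ c → u≢v (position-injective c
    (intercept-injective (toℕ (column u)) (parallel-intersect⇒≡
      -- Rewrites the column of `v` as that of `u`, so that both segments visibly have the same
      -- slope.
      (subst (λ i → Intersect (segment u) (longSegment (toℕ i) (row v))) (sym c) meet))))

  completePartite∈k-DIR : completePartite ∈ k -DIR
  completePartite∈k-DIR = (λ i → stripDirection (slope (toℕ i))) , segment
    , (λ v → column v , stripSegment-∥ (intercept (toℕ (column v)) (row v)) (slope (toℕ (column v))))
    , (λ u v u≢v → mk⇔ ~⇒intersect (intersect⇒~ u≢v))

manyMaximalCliques : ∀ k n .{{_ : ℕ.NonZero k}} → k ℕ.≤ n →
  ∃[ m ] (MaximalCliqueCount k n m × n ℕ.^ k ℕ.≤ (2 ℕ.* k) ℕ.^ k ℕ.* m)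
manyMaximalCliques k n k≤n = _ , (completePartite , completePartite∈k-DIR k n , refl) ,
  ℕ.≤-trans (n^k≤[2k]^k*[n/k]^k k n k≤n) (ℕ.*-monoʳ-≤ ((2 ℕ.* k) ℕ.^ k) [n/k]^k≤#maximalCliques)
  where open Grid k n

-- The inequality `N ≤ D * m` is upward closed in `m`, so it passes from the witness to the maximum.
maximumSatisfies : ∀ {A B : ℕ → Set} N D →
  ∃[ m ] (A m × N ℕ.≤ D ℕ.* m) → (∀ m → N ℕ.≤ D ℕ.* m → B m) → MaximumSatisfies A B
maximumSatisfies N D (m , Am , N≤Dm) bound = (m , Am , bound m N≤Dm) ,
  λ M (_ , max) → bound M (ℕ.≤-trans N≤Dm (ℕ.*-monoʳ-≤ D (max m Am)))

-- Asymptotic bounds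

1/D*n^k≤m : ∀ D n k m .{{_ : ℕ.NonZero D}} → n ℕ.^ k ℕ.≤ D ℕ.* m →
  fromℚ (+ 1 ℚ./ D) * fromℕ n ^ k ≤ fromℕ m
1/D*n^k≤m D n k m bound = ≤-pointwise {fromℚ (+ 1 ℚ./ D) * fromℕ n ^ k} {fromℕ m} λ i → begin
  (+ 1 ℚ./ D) ℚ.* seq (fromℕ n ^ k) i    ≡⟨ cong ((+ 1 ℚ./ D) ℚ.*_) (seq-^ n k i) ⟩
  (+ 1 ℚ./ D) ℚ.* ι (n ℕ.^ k)            ≤⟨ ℚ.*-monoˡ-≤-nonNeg (+ 1 ℚ./ D) {{ℚ.normalize-nonNeg 1 D}} (ι-mono-≤ bound) ⟩
  (+ 1 ℚ./ D) ℚ.* ι (D ℕ.* m)            ≡⟨ cong ((+ 1 ℚ./ D) ℚ.*_) (ι-homo-* D m) ⟩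
  (+ 1 ℚ./ D) ℚ.* (ι D ℚ.* ι m)          ≡⟨ ℚ.*-assoc (+ 1 ℚ./ D) (ι D) (ι m) ⟨
  (+ 1 ℚ./ D) ℚ.* ι D ℚ.* ι m            ≡⟨ cong (ℚ._* ι m) (/-*-cancel 1 D) ⟩
  1ℚ ℚ.* ι m                             ≡⟨ ℚ.*-identityˡ (ι m) ⟩
  ι m                                    ∎
  where open ℚ.≤-Reasoning

archimedean : ∀ {e} → 0ℚ ℚ.< e → ∃[ b ] (+ 1 ℚ./ suc b ℚ.≤ e)
archimedean {e} 0<e = go e {{ℚ.positive 0<e}}
  where
  go : ∀ e → .{{ℚ.Positive e}} → ∃[ b ] (+ 1 ℚ./ suc b ℚ.≤ e)
  -- `d` is the denominator minus one; the numerator is at least 1, so the unit fraction with the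
  -- same denominator works.
  go (mkℚ (+ suc a) d _) = d , ℚ.toℚᵘ-cancel-≤ (ℚᵘ.≤-respˡ-≃ (ℚᵘ.≃-sym (toℚᵘ-/ (+ 1) d))
    (*≤* (ℤ.*-monoʳ-≤-nonNeg (+ suc d) (ℤ.+≤+ (ℕ.s≤s (ℕ.z≤n {a}))))))

-- Multiplication by `q * b` gives the claim; `k * q` is added on the left to avoid truncated
-- subtraction.
clearDenominators : ∀ a q k b .{{_ : ℕ.NonZero q}} .{{_ : ℕ.NonZero b}} →
  + a ℚ./ q ℚ.≤ ι k ℚ.* (1ℚ ℚ.- + 1 ℚ./ b) → a ℕ.* b ℕ.+ k ℕ.* q ℕ.≤ k ℕ.* q ℕ.* b
clearDenominators a q k b le = ι-cancel-≤ (begin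
  ι (a ℕ.* b ℕ.+ k ℕ.* q)                     ≡⟨ ι-homo-+ (a ℕ.* b) (k ℕ.* q) ⟩
  ι (a ℕ.* b) ℚ.+ ι (k ℕ.* q)                 ≡⟨ cong₂ ℚ._+_ (ι-homo-* a b) (ι-homo-* k q) ⟩
  ι a ℚ.* ι b ℚ.+ ι k ℚ.* ι q                 ≡⟨ cong (λ z → z ℚ.* ι b ℚ.+ ι k ℚ.* ι q) (/-*-cancel a q) ⟨
  x ℚ.* ι q ℚ.* ι b ℚ.+ ι k ℚ.* ι q           ≡⟨ cong (ℚ._+ ι k ℚ.* ι q) (ℚ.*-assoc x (ι q) (ι b)) ⟩
  x ℚ.* (ι q ℚ.* ι b) ℚ.+ ι k ℚ.* ι q         ≤⟨ ℚ.+-monoˡ-≤ (ι k ℚ.* ι q) (ℚ.*-monoʳ-≤-nonNeg (ι q ℚ.* ι b) {{nonNeg}} le) ⟩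
  ι k ℚ.* (1ℚ ℚ.- y) ℚ.* (ι q ℚ.* ι b) ℚ.+ ι k ℚ.* ι q
                                              ≡⟨ expand (ι k) y (ι q) (ι b) ⟩
  (ι k ℚ.* ι q ℚ.* ι b ℚ.+ ι k ℚ.* ι q) ℚ.- ι k ℚ.* ι q ℚ.* (y ℚ.* ι b)
                                              ≡⟨ cong (λ z → (ι k ℚ.* ι q ℚ.* ι b ℚ.+ ι k ℚ.* ι q) ℚ.- ι k ℚ.* ι q ℚ.* z) (/-*-cancel 1 b) ⟩
  (ι k ℚ.* ι q ℚ.* ι b ℚ.+ ι k ℚ.* ι q) ℚ.- ι k ℚ.* ι q ℚ.* 1ℚ
                                              ≡⟨ collect (ι k ℚ.* ι q) (ι b) ⟩
  ι k ℚ.* ι q ℚ.* ι b                         ≡⟨ cong (ℚ._* ι b) (ι-homo-* k q) ⟨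
  ι (k ℕ.* q) ℚ.* ι b                         ≡⟨ ι-homo-* (k ℕ.* q) b ⟨
  ι (k ℕ.* q ℕ.* b)                           ∎)
  where
  open ℚ.≤-Reasoning
  x = + a ℚ./ q
  y = + 1 ℚ./ b
  nonNeg : ℚ.NonNegative (ι q ℚ.* ι b)
  nonNeg = ℚ.nonNeg*nonNeg⇒nonNeg (ι q) {{ι-nonNegative q}} (ι b) {{ι-nonNegative b}}
  expand : ∀ k y q b → k ℚ.* (1ℚ ℚ.- y) ℚ.* (q ℚ.* b) ℚ.+ k ℚ.* q ≡
    (k ℚ.* q ℚ.* b ℚ.+ k ℚ.* q) ℚ.- k ℚ.* q ℚ.* (y ℚ.* b)
  expand = solve 4 (λ k y q b → k :* (con 1ℚ :- y) :* (q :* b) :+ k :* q :=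
    (k :* q :* b :+ k :* q) :- k :* q :* (y :* b)) refl
    where open +-*-Solver
  collect : ∀ c b → (c ℚ.* b ℚ.+ c) ℚ.- c ℚ.* 1ℚ ≡ c ℚ.* b
  collect = solve 2 (λ c b → (c :* b :+ c) :- c :* con 1ℚ := c :* b) refl
    where open +-*-Solver

-- Since `D ^ b ≤ n`, the constant costs at most `n ^ q` after raising to the power `b * q`. The
-- slack `k * q` in the exponents pays for it. Cancelling the power of `D` and taking b-th roots by
-- contraposition finishes.
absorbConstant : ∀ {n m} D k a b q
  .{{_ : ℕ.NonZero n}} .{{_ : ℕ.NonZero D}} .{{_ : ℕ.NonZero k}} .{{_ : ℕ.NonZero b}} →
  D ℕ.^ b ℕ.≤ n → n ℕ.^ k ℕ.≤ D ℕ.* m → a ℕ.* b ℕ.+ k ℕ.* q ℕ.≤ k ℕ.* q ℕ.* b →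
  n ℕ.^ a ℕ.≤ m ℕ.^ q
absorbConstant {n} {m} D k a b q D^b≤n n^k≤Dm exponents =
  ℕ.≮⇒≥ λ m^q<n^a → ℕ.<⇒≱ (ℕ.^-monoˡ-< b m^q<n^a)
    (ℕ.*-cancelʳ-≤ ((n ℕ.^ a) ℕ.^ b) ((m ℕ.^ q) ℕ.^ b) (D ℕ.^ (b ℕ.* q)) {{ℕ.m^n≢0 D (b ℕ.* q)}} powers)
  where
  open ℕ.≤-Reasoning
  powers : (n ℕ.^ a) ℕ.^ b ℕ.* D ℕ.^ (b ℕ.* q) ℕ.≤ (m ℕ.^ q) ℕ.^ b ℕ.* D ℕ.^ (b ℕ.* q)
  powers = begin
    (n ℕ.^ a) ℕ.^ b ℕ.* D ℕ.^ (b ℕ.* q)          ≡⟨ cong₂ ℕ._*_ (ℕ.^-*-assoc n a b) (sym (ℕ.^-*-assoc D b q)) ⟩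
    n ℕ.^ (a ℕ.* b) ℕ.* (D ℕ.^ b) ℕ.^ q          ≤⟨ ℕ.*-monoʳ-≤ (n ℕ.^ (a ℕ.* b)) (ℕ.^-monoˡ-≤ q D^b≤n) ⟩
    n ℕ.^ (a ℕ.* b) ℕ.* n ℕ.^ q                  ≤⟨ ℕ.*-monoʳ-≤ (n ℕ.^ (a ℕ.* b)) (ℕ.^-monoʳ-≤ n (ℕ.m≤n*m q k)) ⟩
    n ℕ.^ (a ℕ.* b) ℕ.* n ℕ.^ (k ℕ.* q)          ≡⟨ ℕ.^-distribˡ-+-* n (a ℕ.* b) (k ℕ.* q) ⟨
    n ℕ.^ (a ℕ.* b ℕ.+ k ℕ.* q)                  ≤⟨ ℕ.^-monoʳ-≤ n exponents ⟩
    n ℕ.^ (k ℕ.* q ℕ.* b)                        ≡⟨ cong (n ℕ.^_) (ℕ.*-assoc k q b) ⟩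
    n ℕ.^ (k ℕ.* (q ℕ.* b))                      ≡⟨ ℕ.^-*-assoc n k (q ℕ.* b) ⟨
    (n ℕ.^ k) ℕ.^ (q ℕ.* b)                      ≤⟨ ℕ.^-monoˡ-≤ (q ℕ.* b) n^k≤Dm ⟩
    (D ℕ.* m) ℕ.^ (q ℕ.* b)                      ≡⟨ *-^-distrib D m (q ℕ.* b) ⟩
    D ℕ.^ (q ℕ.* b) ℕ.* m ℕ.^ (q ℕ.* b)          ≡⟨ ℕ.*-comm (D ℕ.^ (q ℕ.* b)) _ ⟩
    m ℕ.^ (q ℕ.* b) ℕ.* D ℕ.^ (q ℕ.* b)          ≡⟨ cong₂ ℕ._*_ (sym (ℕ.^-*-assoc m q b)) (cong (D ℕ.^_) (ℕ.*-comm q b)) ⟩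
    (m ℕ.^ q) ℕ.^ b ℕ.* D ℕ.^ (b ℕ.* q)          ∎

1^q*x : ∀ q x i → seq (1ℝ ^ q * fromℚ x) i ≡ x
1^q*x q x i = trans (cong (ℚ._* x) (trans (seq-^ 1 q i) (cong ι (ℕ.^-zeroˡ q)))) (ℚ.*-identityˡ x)

1^q*x≤m^q : ∀ {x m} q → x ℚ.≤ ι (m ℕ.^ q) → 1ℝ ^ q * fromℚ x ≤ fromℕ m ^ q
1^q*x≤m^q {x} {m} q x≤m^q = ≤-pointwise {1ℝ ^ q * fromℚ x} {fromℕ m ^ q} λ i →
  subst₂ ℚ._≤_ (sym (1^q*x q x i)) (sym (seq-^ m q i)) x≤m^q

1/≤1 : ∀ d .{{_ : ℕ.NonZero d}} → + 1 ℚ./ d ℚ.≤ 1ℚ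
1/≤1 d = ℚ.*-cancelʳ-≤-pos (ι d) {{ι-positive d}} (begin
  (+ 1 ℚ./ d) ℚ.* ι d    ≡⟨ /-*-cancel 1 d ⟩
  ι 1                    ≤⟨ ι-mono-≤ (ℕ.>-nonZero⁻¹ d) ⟩
  ι d                    ≡⟨ ℚ.*-identityˡ (ι d) ⟨
  1ℚ ℚ.* ι d             ∎)
  where open ℚ.≤-Reasoning

n^k[1-ε]≤m : ∀ {ε n m} D k b
  .{{_ : ℕ.NonZero n}} .{{_ : ℕ.NonZero D}} .{{_ : ℕ.NonZero k}} .{{_ : ℕ.NonZero b}} →
  ∃[ N ] (∀ i → N ℕ.≤ i → + 1 ℚ./ b ℚ.≤ seq ε i) →
  D ℕ.^ b ℕ.≤ n → n ℕ.^ k ℕ.≤ D ℕ.* m →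
  1ℝ · n ^ (fromℕ k * (1ℝ - ε)) ≤ᴾ fromℕ m
n^k[1-ε]≤m {ε} {n} {m} D k b (N , 1/b≤ε) D^b≤n n^k≤Dm (+ a) q (e , 0<e , N′ , gap) =
  1^q*x≤m^q {m = m} q (ι-mono-≤ (absorbConstant D k a b q D^b≤n n^k≤Dm (clearDenominators a q k b (begin
    + a ℚ./ q                             ≡⟨ ℚ.+-identityʳ (+ a ℚ./ q) ⟨
    + a ℚ./ q ℚ.+ 0ℚ                      ≤⟨ ℚ.+-monoʳ-≤ (+ a ℚ./ q) (ℚ.<⇒≤ 0<e) ⟩
    -- At the index `N ⊔ N′` both the lower bound on `ε` and the gap below the real exponent hold.
    + a ℚ./ q ℚ.+ e                       ≤⟨ gap (N ℕ.⊔ N′) (ℕ.m≤n⊔m N N′) ⟩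
    ι k ℚ.* (1ℚ ℚ.- seq ε (N ℕ.⊔ N′))     ≤⟨ ℚ.*-monoˡ-≤-nonNeg (ι k) {{ι-nonNegative k}}
                                               (ℚ.+-monoʳ-≤ 1ℚ (ℚ.neg-antimono-≤ (1/b≤ε (N ℕ.⊔ N′) (ℕ.m≤m⊔n N N′)))) ⟩
    ι k ℚ.* (1ℚ ℚ.- + 1 ℚ./ b)            ∎))))
  where open ℚ.≤-Reasoning
n^k[1-ε]≤m {n = n} {m = m} D k b _ _ n^k≤Dm -[1+ a ] q _ =
  -- With a negative exponent the left side is at most 1, and `m ≥ 1` because `D * m ≥ n ^ k > 0`.
  1^q*x≤m^q {m = m} q (ℚ.≤-trans (1/≤1 (n ℕ.^ suc a) {{ℕ.m^n≢0 n (suc a)}}) (ι-mono-≤ (ℕ.m^n>0 m {{m≢0}} q)))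
  where
  m≢0 : ℕ.NonZero m
  m≢0 = ℕ.m*n≢0⇒n≢0 D {{ℕ.>-nonZero (ℕ.<-≤-trans (ℕ.m^n>0 n k) n^k≤Dm)}}

theorem4 : (∀ (ε : ℝ) → 0ℝ < ε →
    ∃[ c ] (0ℝ < c ×
    (∀ k → 2 ℕ.≤ k → ∃[ n₀ ] (∀ n .{{_ : ℕ.NonZero n}} → n₀ ℕ.≤ n →
    MaximumSatisfies (MaximalCliqueCount k n)
    (λ m → c · n ^ (fromℕ k * (1ℝ - ε)) ≤ᴾ fromℕ m)))))
    ×
    (∀ k → 2 ℕ.≤ k →
    ∃[ c ] (0ℝ < c × ∃[ n₀ ] (∀ n → n₀ ℕ.≤ n →
    MaximumSatisfies (MaximalCliqueCount k n)
    (λ m → c * fromℕ n ^ k ≤ fromℕ m))))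
theorem4 = part₁ , part₂
  where
  part₁ : ∀ (ε : ℝ) → 0ℝ < ε →
    ∃[ c ] (0ℝ < c ×
    (∀ k → 2 ℕ.≤ k → ∃[ n₀ ] (∀ n .{{_ : ℕ.NonZero n}} → n₀ ℕ.≤ n →
    MaximumSatisfies (MaximalCliqueCount k n)
    (λ m → c · n ^ (fromℕ k * (1ℝ - ε)) ≤ᴾ fromℕ m))))
  part₁ ε (e , 0<e , N , e≤ε) with archimedean 0<e
  ... | b , 1/b≤e = 1ℝ , (1ℚ , ℚ.positive⁻¹ 1ℚ , 0 , λ _ _ → ℚ.≤-refl) , λ where
    -- The constant has to be chosen before `k`, so all dependence on `k` goes into the threshold:
    -- `n ≥ k` gives a complete row, and `n ≥ D ^ suc b` lets `D` be absorbed.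
    k@(suc _) _ → let D = (2 ℕ.* k) ℕ.^ k in k ℕ.⊔ D ℕ.^ suc b , λ n n₀≤n →
      maximumSatisfies (n ℕ.^ k) D
        (manyMaximalCliques k n (ℕ.m⊔n≤o⇒m≤o k (D ℕ.^ suc b) n₀≤n))
        (λ m → n^k[1-ε]≤m {ε} {n} {m} D k (suc b) {{_}} {{ℕ.m^n≢0 (2 ℕ.* k) k}}
          (N , λ i Ni → ℚ.≤-trans 1/b≤e (subst (ℚ._≤ seq ε i) (ℚ.+-identityˡ e) (e≤ε i Ni)))
          (ℕ.m⊔n≤o⇒n≤o k (D ℕ.^ suc b) n₀≤n))

  part₂ : ∀ k → 2 ℕ.≤ k →
    ∃[ c ] (0ℝ < c × ∃[ n₀ ] (∀ n → n₀ ℕ.≤ n →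
    MaximumSatisfies (MaximalCliqueCount k n)
    (λ m → c * fromℕ n ^ k ≤ fromℕ m)))
  -- Here the constant may depend on `k`, so `1/D` is kept as a factor and the threshold is just
  -- `k`.
  part₂ k@(suc _) _ = fromℚ 1/D , (1/D , 0<1/D , 0 , λ _ _ → ℚ.≤-reflexive (ℚ.+-identityˡ 1/D)) , k , λ n k≤n →
    maximumSatisfies (n ℕ.^ k) D (manyMaximalCliques k n k≤n) (λ m → 1/D*n^k≤m D n k m)
    where
    D = (2 ℕ.* k) ℕ.^ k
    instance
      D≢0 : ℕ.NonZero D
      D≢0 = ℕ.m^n≢0 (2 ℕ.* k) k
    1/D : ℚ
    1/D = + 1 ℚ./ D
    0<1/D : 0ℚ ℚ.< 1/D
    0<1/D = ℚ.positive⁻¹ 1/D {{ℚ.normalize-pos 1 D}}
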